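{- If $T$ is a $5$-way $(v,3,2)$ trade, then the volume of $T$ is at least $12$.
   Context: A $(v,k,t)$ trade is a triple $(X;T_1,T_2)$ where $X$ is a $v$-set and $T_1,T_2$ are disjoint nonempty collections of $k$-subsets (blocks) of $X$ such that every $t$-subset of $X$ is contained in the same number of blocks of $T_1$ as of $T_2$. A $\mu$-way $(v,k,t)$ trade is a pair $T=(X,\{T_1,\dots,T_\mu\})$ such that for every $i\neq j$, $(X;T_i,T_j)$ is a $(v,k,t)$ trade. The volume of $T$ is the common number of blocks of the $T_i$. -}

module Defs where

open import Data.Nat using (ℕ; _≤_)
open import Data.Fin using (Fin)
open import Data.Fin.Subset using (Subset; ∣_∣; _⊆_)
open import Data.Fin.Subset.Properties using (_⊆?_)
open import Data.List using (List; []; length; filter)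
open import Data.List.Membership.Propositional using (_∈_)
open import Data.List.Relation.Unary.Unique.Propositional using (Unique)
open import Data.Empty using (⊥)
open import Relation.Binary.PropositionalEquality using (_≡_; _≢_)

-- The point set X is Fin v.  A collection of blocks is a duplicate-free list
-- of subsets of Fin v (i.e. a finite set of subsets).

AllSize : {v : ℕ} → ℕ → List (Subset v) → Set
AllSize {v} k T = ∀ (b : Subset v) → b ∈ T → ∣ b ∣ ≡ k

occ : {v : ℕ} → Subset v → List (Subset v) → ℕ
occ s T = length (filter (s ⊆?_) T)

record BlockCollection (v k : ℕ) (T : List (Subset v)) : Set where
  field
    unique : Unique T
    sizes  : AllSize k T

record IsTrade (v k t : ℕ) (T₁ T₂ : List (Subset v)) : Set where
  field
    coll₁     : BlockCollection v k T₁
    coll₂     : BlockCollection v k T₂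
    nonempty₁ : T₁ ≢ []
    nonempty₂ : T₂ ≢ []
    disjoint  : ∀ (b : Subset v) → b ∈ T₁ → b ∈ T₂ → ⊥
    balanced  : ∀ (s : Subset v) → ∣ s ∣ ≡ t → occ s T₁ ≡ occ s T₂

IsMuWayTrade : (μ v k t : ℕ) → (Fin μ → List (Subset v)) → Set
IsMuWayTrade μ v k t T = ∀ (i j : Fin μ) → i ≢ j → IsTrade v k t (T i) (T j)

-- volume: the (common) number of blocks of the T_i; we measure T_i for any i

{-# OPTIONS --safe #-}

-- Suppose some T_i has at most 11 blocks, and let r(x) be its number of blocks through x, so that
-- Σ r(x) ≤ 33.  A pair covered d times has 5d distinct third points, since the T_j are disjoint.
-- Hence every covered point has r ≥ 3, and a pair covered twice would give 12 covered points, which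
-- is too many.  So each T_j is a partial triple system and x has exactly 2 r(x) neighbours.  Some x
-- has r(x) = 3 (otherwise nine points have r ≥ 4); its closed neighbourhood S is then a clique K₇.
-- If r = 3 on all of S, the T_j restrict to disjoint Fano planes on S, of which there are at most two.
-- Otherwise two points o, o′ outside S are covered, and counting weights shows that there are no others.
-- Parity of the degrees leaves the graphs K₉ − K₃ and K₉ − K₂,₂.  The resulting configurations on
-- seven or nine points are excluded by a verified backtracking search; for K₇ and K₉ − K₃ the T_j
-- are numbered according to their blocks through one fixed pair, which makes the search short.
module Submission where

open import Defs
open import Data.Bool using (Bool; true; false; if_then_else_; _∨_)
import Data.Bool as Bool
open import Data.Bool.ListAction using (all)
open import Data.Bool.Properties using (T?)
open import Data.Empty using (⊥; ⊥-elim)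
open import Data.Fin using (Fin; zero; suc; toℕ; cast) renaming (_<_ to _<ᶠ_; _<?_ to _<ᶠ?_)
open import Data.Fin.Patterns using (0F; 1F; 2F; 3F)
import Data.Fin.Properties as Fin
open import Data.Fin.Subset using (Subset; ∣_∣; ⁅_⁆; _∪_; inside; outside) renaming (_∈_ to _∈ˢ_; _⊆_ to _⊆ˢ_)
open import Data.Fin.Subset.Properties using (x∈⁅x⁆; x∈⁅y⁆⇒x≡y; x∈p∪q⁻; x∈p∪q⁺; ∣⁅x⁆∣≡1; ∪-identityˡ; ∪-identityʳ; ⊆-antisym) renaming (_∈?_ to _∈ˢ?_; _⊆?_ to _⊆ˢ?_)
open import Data.List using (List; []; _∷_; [_]; _++_; length; filter; map; concatMap; cartesianProduct; allFin; lookup)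
import Data.List.Membership.DecPropositional as DecMembership
open import Data.List.Membership.Propositional using (_∈_; _∉_; find; lose)
open import Data.List.Membership.Propositional.Properties using (∈-map⁺; ∈-map⁻; ∈-++⁺ˡ; ∈-++⁺ʳ; ∈-++⁻; ∈-concatMap⁺; ∈-concatMap⁻; ∈-filter⁺; ∈-filter⁻; ∈-lookup; ∈-allFin)
open import Data.List.Properties using (length-map; length-++; filter-notAll; filter-all; map-++)
open import Data.List.Relation.Binary.Subset.Propositional using (_⊆_)
open import Data.List.Relation.Unary.All as All using (All; []; _∷_)
import Data.List.Relation.Unary.All.Properties as All
open import Data.List.Relation.Unary.AllPairs using ([]; _∷_)
open import Data.List.Relation.Unary.Any as Any using (Any; here; there)
import Data.List.Relation.Unary.Any.Properties as Any
open import Data.List.Relation.Unary.Unique.Propositional using (Unique)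
import Data.List.Relation.Unary.Unique.Propositional.Properties as Unique
open import Data.Nat using (ℕ; zero; suc; _+_; _*_; _≤_; _≤?_; _≟_; _<ᵇ_; z≤n; s≤s)
open import Data.Nat.ListAction using (sum)
open import Data.Nat.ListAction.Properties using (sum-++)
open import Data.Nat.Properties hiding (_≟_; _≤?_)
open import Data.Nat.Tactic.RingSolver using (solve-∀)
open import Data.Product using (∃-syntax; _×_; _,_; proj₁; proj₂; uncurry)
open import Data.Sum using (_⊎_; inj₁; inj₂; [_,_]′)
open import Data.Unit using (tt)
open import Data.Vec using ([]; _∷_; here; there)
open import Function using (_∘_; case_of_)
open import Level using (Level)
open import Relation.Binary.Definitions using (Decidable; DecidableEquality)
open import Relation.Binary.PropositionalEquality using (_≡_; _≢_; refl; sym; trans; cong; cong₂; subst; ≢-sym)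
open import Relation.Nullary using (¬_; Dec; yes; no; contradiction)
open import Relation.Nullary.Decidable using (¬?; _×-dec_; _⊎-dec_)

private
  variable
    a b : Level
    A : Set a
    B : Set b

-- Duplicate-free lists

unique-∷ : {x : A} {xs : List A} → x ∉ xs → Unique xs → Unique (x ∷ xs)
unique-∷ x∉xs u = All.¬Any⇒All¬ _ x∉xs ∷ u

unique-concatMap : {f : A → List B} {xs : List A} → Unique xs →
  (∀ {x} → x ∈ xs → Unique (f x)) →
  (∀ {x y z} → x ∈ xs → y ∈ xs → z ∈ f x → z ∈ f y → x ≡ y) →
  Unique (concatMap f xs)
unique-concatMap [] _ _ = []
unique-concatMap {f = f} {x ∷ xs} (x∉xs ∷ u) uf dis =
  Unique.++⁺ (uf (here refl)) (unique-concatMap u (uf ∘ there) (λ p q → dis (there p) (there q)))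
    λ (z∈fx , z∈rest) → let (y , y∈xs , z∈fy) = find (∈-concatMap⁻ f z∈rest)
                        in All.lookup x∉xs y∈xs (dis (here refl) (there y∈xs) z∈fx z∈fy)

length-concatMap : ∀ {k} (f : A → List B) (xs : List A) →
  (∀ {x} → x ∈ xs → length (f x) ≡ k) → length (concatMap f xs) ≡ length xs * k
length-concatMap f [] _ = refl
length-concatMap f (x ∷ xs) lf =
  trans (length-++ (f x)) (cong₂ _+_ (lf (here refl)) (length-concatMap f xs (lf ∘ there)))

inhabited : {xs : List A} → 1 ≤ length xs → ∃[ x ] x ∈ xs
inhabited {xs = x ∷ _} _ = x , here refl

two-elements : {xs : List A} → Unique xs → 2 ≤ length xs → ∃[ x ] ∃[ y ] x ∈ xs × y ∈ xs × x ≢ y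
two-elements {xs = x ∷ y ∷ _} ((x≢y ∷ _) ∷ _) _ = x , y , here refl , there (here refl) , x≢y
two-elements {xs = _ ∷ []} _ (s≤s ())

lookup-injective : {xs : List A} → Unique xs → ∀ {i j} → lookup xs i ≡ lookup xs j → i ≡ j
lookup-injective (x∉ ∷ u) {zero} {zero} eq = refl
lookup-injective (x∉ ∷ u) {zero} {suc j} eq = contradiction eq (All.lookup x∉ (∈-lookup j))
lookup-injective (x∉ ∷ u) {suc i} {zero} eq = contradiction (sym eq) (All.lookup x∉ (∈-lookup i))
lookup-injective (x∉ ∷ u) {suc i} {suc j} eq = cong suc (lookup-injective u eq)

-- Lets a list of known length be indexed by a fixed `Fin n`, as the search graphs require. The
-- leading entries of `xs` are still found by computation, so `at 0F` reduces to the head.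
module Enumeration {n : ℕ} (xs : List A) (eq : length xs ≡ n) where
  at : Fin n → A
  at k = lookup xs (cast (sym eq) k)

  at-∈ : ∀ k → at k ∈ xs
  at-∈ k = ∈-lookup (cast (sym eq) k)

  at-injective : Unique xs → ∀ {p q} → at p ≡ at q → p ≡ q
  at-injective u {p} {q} h = Fin.toℕ-injective
    (trans (sym (Fin.toℕ-cast (sym eq) p)) (trans (cong toℕ (lookup-injective u h)) (Fin.toℕ-cast (sym eq) q)))

  ∈⇒at : ∀ {x} → x ∈ xs → ∃[ k ] x ≡ at k
  ∈⇒at x∈xs = cast eq (Any.index x∈xs) , trans (Any.lookup-index x∈xs)
    (cong (lookup xs) (sym (trans (Fin.cast-trans eq (sym eq) _) (Fin.cast-is-id _ _))))

module DecList {A : Set a} (_≟_ : DecidableEquality A) where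
  open DecMembership _≟_ using (_∈?_)

  infixl 6 _∖_
  _∖_ : List A → A → List A
  xs ∖ x = filter (λ y → ¬? (y ≟ x)) xs

  ∈-∖⁺ : ∀ {x y xs} → y ∈ xs → y ≢ x → y ∈ xs ∖ x
  ∈-∖⁺ = ∈-filter⁺ _

  ∈-∖⁻ : ∀ {x y} xs → y ∈ xs ∖ x → y ∈ xs × y ≢ x
  ∈-∖⁻ xs = ∈-filter⁻ _ {xs = xs}

  unique-∖ : ∀ {x xs} → Unique xs → Unique (xs ∖ x)
  unique-∖ = Unique.filter⁺ _

  -- Each entry of `xs` is deleted from `ys` in turn, and every deletion strictly shortens `ys`.
  pigeonhole : ∀ {xs ys} → Unique xs → xs ⊆ ys → length xs ≤ length ys
  pigeonhole [] _ = z≤n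
  pigeonhole {x ∷ xs} {ys} (x∉xs ∷ u) sub = ≤-trans
    (s≤s (pigeonhole u λ z∈xs → ∈-∖⁺ (sub (there z∈xs)) (≢-sym (All.lookup x∉xs z∈xs))))
    (filter-notAll _ ys (Any.map (λ eq ≢ → ≢ (sym eq)) (sub (here refl))))

  length-∖ : ∀ {x xs} → Unique xs → x ∈ xs → length xs ≡ suc (length (xs ∖ x))
  length-∖ {x} {xs} u x∈xs = ≤-antisym
    (pigeonhole u λ {y} y∈xs → case y ≟ x of λ where
      (yes refl) → here refl
      (no y≢x) → there (∈-∖⁺ y∈xs y≢x))
    (filter-notAll _ xs (Any.map (λ eq ≢ → ≢ (sym eq)) x∈xs))

  -- An entry of `ys` missing from `xs` would extend `xs` to a duplicate-free list longer than `ys`.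
  -- This turns counting bounds into equalities of neighbourhoods.
  saturated : ∀ {xs ys} → Unique xs → xs ⊆ ys → length ys ≤ length xs → ys ⊆ xs
  saturated {xs} {ys} u sub le {y} y∈ys with y ∈? xs
  ... | yes y∈xs = y∈xs
  ... | no y∉xs = contradiction
    (≤-trans (pigeonhole (unique-∷ y∉xs u) λ { (here refl) → y∈ys ; (there z∈xs) → sub z∈xs }) le) 1+n≰n

private
  swap : ∀ a b c → a + (b + c) ≡ b + (a + c)
  swap = solve-∀

  double : ∀ m → m * 2 ≡ m + m
  double = solve-∀

half-≤ : ∀ {m n} → m + m ≤ n * 2 → m ≤ n
half-≤ {m} {n} h = *-cancelʳ-≤ m n 2 (≤-trans (≤-reflexive (double m)) h)

-- The parity step: neighbourhoods have even size, so an odd lower bound on their size improves by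
-- one.
odd-half-≤ : ∀ {m n} → suc (m + m) ≤ n * 2 → suc m ≤ n
odd-half-≤ {m} h = ≰⇒> λ n≤m → 1+n≰n (≤-trans h (≤-trans (*-monoˡ-≤ 2 n≤m) (≤-reflexive (double m))))

-- Subsets as lists of points

elements : ∀ {n} → Subset n → List (Fin n)
elements [] = []
elements (inside ∷ p) = zero ∷ map suc (elements p)
elements (outside ∷ p) = map suc (elements p)

length-elements : ∀ {n} (p : Subset n) → length (elements p) ≡ ∣ p ∣
length-elements [] = refl
length-elements (inside ∷ p) = cong suc (trans (length-map suc (elements p)) (length-elements p))
length-elements (outside ∷ p) = trans (length-map suc (elements p)) (length-elements p)

∈-elements⁺ : ∀ {n x} {p : Subset n} → x ∈ˢ p → x ∈ elements p
∈-elements⁺ {p = inside ∷ p} here = here refl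
∈-elements⁺ {p = inside ∷ p} (there x∈p) = there (∈-map⁺ suc (∈-elements⁺ x∈p))
∈-elements⁺ {p = outside ∷ p} (there x∈p) = ∈-map⁺ suc (∈-elements⁺ x∈p)

∈-elements⁻ : ∀ {n x} {p : Subset n} → x ∈ elements p → x ∈ˢ p
∈-elements⁻ {p = inside ∷ p} (here refl) = here
∈-elements⁻ {p = inside ∷ p} (there x∈) with _ , y∈ , refl ← ∈-map⁻ suc x∈ = there (∈-elements⁻ y∈)
∈-elements⁻ {p = outside ∷ p} x∈ with _ , y∈ , refl ← ∈-map⁻ suc x∈ = there (∈-elements⁻ y∈)

unique-elements : ∀ {n} (p : Subset n) → Unique (elements p)
unique-elements [] = []
unique-elements (inside ∷ p) =
  unique-∷ (λ 0∈ → case ∈-map⁻ suc 0∈ of λ ()) (Unique.map⁺ Fin.suc-injective (unique-elements p))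
unique-elements (outside ∷ p) = Unique.map⁺ Fin.suc-injective (unique-elements p)

∣pair∣≡2 : ∀ {n} {x y : Fin n} → x ≢ y → ∣ ⁅ x ⁆ ∪ ⁅ y ⁆ ∣ ≡ 2
∣pair∣≡2 {x = zero} {zero} x≢y = contradiction refl x≢y
∣pair∣≡2 {x = zero} {suc y} _ = cong suc (trans (cong ∣_∣ (∪-identityˡ ⁅ y ⁆)) (∣⁅x⁆∣≡1 y))
∣pair∣≡2 {x = suc x} {zero} _ = cong suc (trans (cong ∣_∣ (∪-identityʳ ⁅ x ⁆)) (∣⁅x⁆∣≡1 x))
∣pair∣≡2 {x = suc x} {suc y} x≢y = ∣pair∣≡2 (x≢y ∘ cong suc)

pair⊆ : ∀ {n} {x y : Fin n} {p} → x ∈ˢ p → y ∈ˢ p → ⁅ x ⁆ ∪ ⁅ y ⁆ ⊆ˢ p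
pair⊆ {x = x} {y} x∈p y∈p z∈ with x∈p∪q⁻ ⁅ x ⁆ ⁅ y ⁆ z∈
... | inj₁ z∈x with refl ← x∈⁅y⁆⇒x≡y x z∈x = x∈p
... | inj₂ z∈y with refl ← x∈⁅y⁆⇒x≡y y z∈y = y∈p

module _ {n : ℕ} where
  open DecList (Fin._≟_ {n})

  length-elements-∖ : ∀ {k x} {p : Subset n} → ∣ p ∣ ≡ suc k → x ∈ˢ p → length (elements p ∖ x) ≡ k
  length-elements-∖ {p = p} sz x∈p = suc-injective
    (trans (sym (length-∖ (unique-elements p) (∈-elements⁺ x∈p))) (trans (length-elements p) sz))

  length-elements-∖∖ : ∀ {k x y} {p : Subset n} → ∣ p ∣ ≡ suc (suc k) → x ∈ˢ p → y ∈ˢ p → x ≢ y →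
    length (elements p ∖ x ∖ y) ≡ k
  length-elements-∖∖ {p = p} sz x∈p y∈p x≢y = suc-injective
    (trans (sym (length-∖ (unique-∖ (unique-elements p)) (∈-∖⁺ (∈-elements⁺ y∈p) (≢-sym x≢y))))
           (length-elements-∖ sz x∈p))

  elements-⊆ : ∀ {p : Subset n} {xs} → Unique xs → All (_∈ˢ p) xs → ∣ p ∣ ≤ length xs → elements p ⊆ xs
  elements-⊆ {p} u xs⊆p le =
    saturated u (∈-elements⁺ ∘ All.lookup xs⊆p) (≤-trans (≤-reflexive (length-elements p)) le)

  subset-≡ : ∀ {p q : Subset n} {xs} → Unique xs → All (_∈ˢ p) xs → All (_∈ˢ q) xs →
    ∣ p ∣ ≤ length xs → ∣ q ∣ ≤ length xs → p ≡ q
  subset-≡ u ps qs lp lq = ⊆-antisym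
    (All.lookup qs ∘ elements-⊆ u ps lp ∘ ∈-elements⁺)
    (All.lookup ps ∘ elements-⊆ u qs lq ∘ ∈-elements⁺)

  -- Degrees and weights of points

  degree : Fin n → List (Subset n) → ℕ
  degree x T = length (filter (x ∈ˢ?_) T)

  weight : List (Subset n) → List (Fin n) → ℕ
  weight T xs = sum (map (λ x → degree x T) xs)

  weight-++ : ∀ T xs ys → weight T (xs ++ ys) ≡ weight T xs + weight T ys
  weight-++ T xs ys = trans (cong sum (map-++ _ xs ys)) (sum-++ (map _ xs) (map _ ys))

  weight-≥ : ∀ T {k xs} → All (λ x → k ≤ degree x T) xs → length xs * k ≤ weight T xs
  weight-≥ T [] = z≤n
  weight-≥ T (k≤ ∷ ks) = +-mono-≤ k≤ (weight-≥ T ks)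

  weight-∷ : ∀ β T xs → weight (β ∷ T) xs ≡ length (filter (_∈ˢ? β) xs) + weight T xs
  weight-∷ β T [] = refl
  weight-∷ β T (x ∷ xs) with x ∈ˢ? β
  ... | yes _ = cong suc (trans (cong (degree x T +_) (weight-∷ β T xs)) (swap (degree x T) (length (filter (_∈ˢ? β) xs)) (weight T xs)))
  ... | no _ = trans (cong (degree x T +_) (weight-∷ β T xs)) (swap (degree x T) (length (filter (_∈ˢ? β) xs)) (weight T xs))

  -- Double counting of incidences: a block of size `k` contains at most `k` entries of a
  -- duplicate-free list.
  weight-≤ : ∀ {k} T {xs} → Unique xs → AllSize k T → weight T xs ≤ length T * k
  weight-≤ [] {xs} u _ = ≤-reflexive (zeros xs)
    where
    zeros : ∀ xs → weight [] xs ≡ 0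
    zeros [] = refl
    zeros (_ ∷ xs) = zeros xs
  weight-≤ {k} (β ∷ T) {xs} u sz = ≤-trans (≤-reflexive (weight-∷ β T xs)) (+-mono-≤
    (≤-trans (pigeonhole (Unique.filter⁺ (_∈ˢ? β) u) (∈-elements⁺ ∘ proj₂ ∘ ∈-filter⁻ (_∈ˢ? β) {xs = xs}))
             (≤-reflexive (trans (length-elements β) (sz β (here refl)))))
    (weight-≤ T u (λ γ → sz γ ∘ there)))

-- Verified backtracking search

-- A clause is a list of alternatives, one of which holds.  The search branches on a shortest clause;
-- _≋_ only serves to discard satisfied clauses, so soundness needs nothing of it.
module Refuter {A : Set} {_#_ _≋_ : A → A → Set} (_#?_ : Decidable _#_) (_≋?_ : Decidable _≋_) where

  private
    keep : List A → List A × List (List A) → List A × List (List A)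
    keep d (m , r) = m , d ∷ r

  shortest : List A → List (List A) → List A × List (List A)
  shortest c [] = c , []
  shortest c (d ∷ ds) =
    if length d <ᵇ length c then keep c (shortest d ds) else keep d (shortest c ds)

  assign : A → List (List A) → List (List A)
  assign x cs = map (filter (λ y → ¬? (x #? y))) (filter (λ c → ¬? (Any.any? (x ≋?_) c)) cs)

  mutual
    refutes : ℕ → List (List A) → Bool
    -- Exhausted depth counts as failure, so soundness needs no termination argument.
    refutes zero _ = false
    refutes (suc k) [] = false
    refutes (suc k) (c ∷ cs) = branch k (shortest c cs)

    branch : ℕ → List A × List (List A) → Bool
    -- An empty `m` has no branch left and is refuted at once.
    branch k (m , r) = all (λ x → refutes k (assign x r)) m

  module _ {⟦_⟧ : A → Set} (consistent : ∀ {x y} → ⟦ x ⟧ → ⟦ y ⟧ → ¬ x # y) where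

    private
      Sat : List (List A) → Set
      Sat = All (Any ⟦_⟧)

    shortest-sat : ∀ c cs → Sat (c ∷ cs) → Any ⟦_⟧ (proj₁ (shortest c cs)) × Sat (proj₂ (shortest c cs))
    shortest-sat c [] (s ∷ []) = s , []
    shortest-sat c (d ∷ ds) (sc ∷ sd ∷ ss) with length d <ᵇ length c
    ... | true  = let (p , q) = shortest-sat d ds (sd ∷ ss) in p , sc ∷ q
    ... | false = let (p , q) = shortest-sat c ds (sc ∷ ss) in p , sd ∷ q

    filter-sat : ∀ {x} → ⟦ x ⟧ → ∀ {c} → Any ⟦_⟧ c → Any ⟦_⟧ (filter (λ y → ¬? (x #? y)) c)
    filter-sat {x} sx {y ∷ c} sc with x #? y | sc
    ... | yes x#y | here sy = contradiction x#y (consistent sx sy)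
    ... | yes _   | there s = filter-sat sx s
    ... | no _    | here sy = here sy
    ... | no _    | there s = there (filter-sat sx s)

    assign-sat : ∀ {x cs} → ⟦ x ⟧ → Sat cs → Sat (assign x cs)
    assign-sat sx ss = All.map⁺ (All.map (filter-sat sx) (All.filter⁺ _ ss))

    mutual
      refutes-sound : ∀ k cs → refutes k cs ≡ true → ¬ Sat cs
      refutes-sound (suc k) (c ∷ cs) eq ss =
        let (s , ss′) = shortest-sat c cs ss in branch-sound k _ _ eq s ss′

      branch-sound : ∀ k m r → branch k (m , r) ≡ true → Any ⟦_⟧ m → ¬ Sat r
      branch-sound k (x ∷ m) r eq s ss with refutes k (assign x r) in eqx | s
      ... | true | here sx = refutes-sound k _ eqx (assign-sat sx ss)
      ... | true | there s′ = branch-sound k m r eq s′ ss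

-- Triple systems as clauses

module Blocks (n : ℕ) where

  open DecMembership (Fin._≟_ {n}) using (_∈?_)

  Atom : Set
  Atom = Fin 5 × List (Fin n)

  -- The same block arises from different edges with its points in different orders, so blocks are
  -- compared by the number of shared points and not as lists.
  common : List (Fin n) → List (Fin n) → List (Fin n)
  common ps qs = filter (λ q → q ∈? ps) qs

  -- Two blocks of one system share at most one point, and a block lies in only one system.
  _#_ _≋_ : Atom → Atom → Set
  (i , ps) # (j , qs) = (i ≡ j × length (common ps qs) ≡ 2) ⊎ (i ≢ j × length (common ps qs) ≡ 3)
  (i , ps) ≋ (j , qs) = i ≡ j × length (common ps qs) ≡ 3

  _#?_ : Decidable _#_
  (i , ps) #? (j , qs) =
    ((i Fin.≟ j) ×-dec (length (common ps qs) ≟ 2)) ⊎-dec (¬? (i Fin.≟ j) ×-dec (length (common ps qs) ≟ 3))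

  _≋?_ : Decidable _≋_
  (i , ps) ≋? (j , qs) = (i Fin.≟ j) ×-dec (length (common ps qs) ≟ 3)

  open Refuter _#?_ _≋?_ public

  module _ (adj : Fin n → Fin n → Bool) where

    Completes : Fin n → Fin n → Fin n → Set
    Completes p q r = r ≢ p × r ≢ q × Bool.T (adj p r) × Bool.T (adj q r)

    completes? : ∀ p q → (r : Fin n) → Dec (Completes p q r)
    completes? p q r = ¬? (r Fin.≟ p) ×-dec ¬? (r Fin.≟ q) ×-dec T? (adj p r) ×-dec T? (adj q r)

    -- Encodes that system `i` covers the edge `(p , q)`: the alternatives are the triangles of the
    -- graph on that edge.
    clause : Fin 5 → Fin n × Fin n → List Atom
    clause i (p , q) = map (λ r → i , p ∷ q ∷ r ∷ []) (filter (completes? p q) (allFin n))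

    edge? : Decidable (λ p q → p <ᶠ q × Bool.T (adj p q))
    edge? p q = (p <ᶠ? q) ×-dec T? (adj p q)

    edges : List (Fin n × Fin n)
    edges = filter (uncurry edge?) (cartesianProduct (allFin n) (allFin n))

    clauses : List (Fin 5) → List (List Atom)
    clauses is = concatMap (λ i → map (clause i) edges) is

    -- A record, so that using a refutation does not make the type checker repeat the search;
    -- 100 bounds its depth.
    record Refutation (given : List Atom) (is : List (Fin 5)) : Set where
      constructor by-search
      field
        search : refutes 100 (map [_] given ++ clauses is) ≡ true

-- The three graphs and their refutations

K₇-adj : Fin 7 → Fin 7 → Bool
K₇-adj _ _ = true

-- Vertices 0, 1, 2 stand for `x`, `o`, `o′`; the other six stand for `N`.
K₉-K₃-adj : Fin 9 → Fin 9 → Bool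
K₉-K₃-adj p q = full p ∨ full q
  where
  full : Fin 9 → Bool
  full 0F = false
  full 1F = false
  full 2F = false
  full (suc (suc (suc _))) = true

-- Vertices 0, 1 stand for `x` and a point `s` of `N`, vertices 2, 3 for `o` and `o′`. Only the four
-- edges between these two pairs are missing.
K₉-K₂₂-adj : Fin 9 → Fin 9 → Bool
K₉-K₂₂-adj p q = compatible (part p) (part q)
  where
  part : Fin 9 → Fin 3
  part 0F = 0F
  part 1F = 0F
  part 2F = 1F
  part 3F = 1F
  part (suc (suc (suc (suc _)))) = 2F
  compatible : Fin 3 → Fin 3 → Bool
  compatible 2F _ = true
  compatible 0F 1F = false
  compatible 1F 0F = false
  compatible _ _ = true

K₇-given : Fin 5 → Blocks.Atom 7
K₇-given j = j , 0F ∷ 1F ∷ suc (suc j) ∷ []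

K₉-K₃-given : Fin 5 → Blocks.Atom 9
K₉-K₃-given j = j , 0F ∷ 3F ∷ suc (suc (suc (suc j))) ∷ []

-- Covering clauses for three systems are enough, since three pairwise disjoint Fano planes on the
-- same seven points do not exist.
K₇-refutation : Blocks.Refutation 7 K₇-adj (map K₇-given (allFin 5)) (0F ∷ 1F ∷ 2F ∷ [])
K₇-refutation = Blocks.by-search refl

-- Adding the block on 0, 1, 2 would make every system a Steiner triple system on nine points, any
-- two sharing just that block; four such systems already clash.
K₉-K₃-refutation : Blocks.Refutation 9 K₉-K₃-adj (map K₉-K₃-given (allFin 5)) (0F ∷ 1F ∷ 2F ∷ 3F ∷ [])
K₉-K₃-refutation = Blocks.by-search refl

-- A single system fails without any given block: the graph has 36 - 4 = 32 edges, which is not a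
-- multiple of three.
K₉-K₂₂-refutation : Blocks.Refutation 9 K₉-K₂₂-adj [] (0F ∷ [])
K₉-K₂₂-refutation = Blocks.by-search refl

-- Covered pairs and third points

open IsTrade
open BlockCollection

pair : ∀ {n} → Fin n → Fin n → Subset n
pair x y = ⁅ x ⁆ ∪ ⁅ y ⁆

module Trade {v : ℕ} (T : Fin 5 → List (Subset v)) (trade : IsMuWayTrade 5 v 3 2 T) where
  open DecList (Fin._≟_ {v})

  private
    -- Facts about a single `T i` are stored in its trades with other systems, so a second index has
    -- to be supplied.
    other : (i : Fin 5) → ∃[ j ] i ≢ j
    other zero = 1F , λ ()
    other (suc i) = 0F , λ ()

    collection : ∀ i → BlockCollection v 3 (T i)
    collection i = coll₁ (trade i _ (proj₂ (other i)))

  T-unique : ∀ i → Unique (T i)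
  T-unique i = unique (collection i)

  T-size : ∀ {i} → AllSize 3 (T i)
  T-size {i} = sizes (collection i)

  T-nonempty : ∀ i → T i ≢ []
  T-nonempty i = nonempty₁ (trade i _ (proj₂ (other i)))

  T-disjoint : ∀ {i j β} → β ∈ T i → β ∈ T j → i ≡ j
  T-disjoint {i} {j} {β} β∈i β∈j with i Fin.≟ j
  ... | yes i≡j = i≡j
  ... | no i≢j = ⊥-elim (disjoint (trade i j i≢j) β β∈i β∈j)

  occ-≡ : ∀ {x y} → x ≢ y → ∀ i j → occ (pair x y) (T i) ≡ occ (pair x y) (T j)
  occ-≡ x≢y i j with i Fin.≟ j
  ... | yes refl = refl
  ... | no i≢j = balanced (trade i j i≢j) _ (∣pair∣≡2 x≢y)

  Joint : Fin 5 → Fin v → Fin v → Set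
  Joint i x y = ∃[ β ] β ∈ T i × x ∈ˢ β × y ∈ˢ β

  -- Chosen so that its length is `occ (pair x y) (T i)` by definition.
  through : Fin 5 → Fin v → Fin v → List (Subset v)
  through i x y = filter (pair x y ⊆ˢ?_) (T i)

  ∈-through⁺ : ∀ {i x y β} → β ∈ T i → x ∈ˢ β → y ∈ˢ β → β ∈ through i x y
  ∈-through⁺ {i} {x} {y} β∈T x∈β y∈β = ∈-filter⁺ (pair x y ⊆ˢ?_) {xs = T i} β∈T λ {_} → pair⊆ x∈β y∈β

  ∈-through⁻ : ∀ {i x y β} → β ∈ through i x y → β ∈ T i × x ∈ˢ β × y ∈ˢ β
  ∈-through⁻ {i} {x} {y} β∈ = let (β∈T , xy⊆β) = ∈-filter⁻ (pair x y ⊆ˢ?_) {xs = T i} β∈ in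
    β∈T , xy⊆β (x∈p∪q⁺ (inj₁ (x∈⁅x⁆ x))) , xy⊆β (x∈p∪q⁺ {p = ⁅ x ⁆} (inj₂ (x∈⁅x⁆ y)))

  joint⇒occ : ∀ {i x y} → Joint i x y → 1 ≤ occ (pair x y) (T i)
  joint⇒occ (_ , β∈T , x∈β , y∈β) = ∈⇒length≥1 (∈-through⁺ β∈T x∈β y∈β)
    where
    ∈⇒length≥1 : ∀ {β} {βs : List (Subset v)} → β ∈ βs → 1 ≤ length βs
    ∈⇒length≥1 (here _) = s≤s z≤n
    ∈⇒length≥1 (there _) = s≤s z≤n

  occ⇒joint : ∀ {i x y} → 1 ≤ occ (pair x y) (T i) → Joint i x y
  occ⇒joint h = let (β , β∈) = inhabited h in β , ∈-through⁻ β∈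

  -- Balance makes the graph of covered pairs the same for all five systems.
  transfer : ∀ {i x y} → x ≢ y → Joint i x y → ∀ j → Joint j x y
  transfer x≢y xy j = occ⇒joint (≤-trans (joint⇒occ xy) (≤-reflexive (occ-≡ x≢y _ j)))

  thirdsIn : Fin v → Fin v → Fin 5 → List (Fin v)
  thirdsIn x y i = concatMap (λ β → elements β ∖ x ∖ y) (through i x y)

  thirds : Fin v → Fin v → List (Fin v)
  thirds x y = concatMap (thirdsIn x y) (allFin 5)

  record IsTriple (x y z : Fin v) (β : Subset v) : Set where
    constructor triple
    field
      z≢x : z ≢ x
      z≢y : z ≢ y
      x∈  : x ∈ˢ β
      y∈  : y ∈ˢ β
      z∈  : z ∈ˢ β
  open IsTriple

  -- Three distinct points fill a block of size three. The indices are independent because blocks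
  -- are compared both within one system and across two.
  triple-≡ : ∀ {i j β γ x y z} → β ∈ T i → γ ∈ T j → x ≢ y → IsTriple x y z β → IsTriple x y z γ → β ≡ γ
  triple-≡ β∈T γ∈T x≢y s t = subset-≡
    ((x≢y ∷ ≢-sym (z≢x s) ∷ []) ∷ (≢-sym (z≢y s) ∷ []) ∷ [] ∷ [])
    (x∈ s ∷ y∈ s ∷ z∈ s ∷ []) (x∈ t ∷ y∈ t ∷ z∈ t ∷ [])
    (≤-reflexive (T-size _ β∈T)) (≤-reflexive (T-size _ γ∈T))

  third⁻ : ∀ {i x y z β} → β ∈ through i x y → z ∈ elements β ∖ x ∖ y → IsTriple x y z β
  third⁻ {x = x} {β = β} β∈ z∈ =
    let (_ , x∈β , y∈β) = ∈-through⁻ β∈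
        (z∈β∖x , z≢y) = ∈-∖⁻ (elements β ∖ x) z∈
        (z∈β , z≢x) = ∈-∖⁻ (elements β) z∈β∖x
    in triple z≢x z≢y x∈β y∈β (∈-elements⁻ z∈β)

  thirdsIn⁻ : ∀ {i x y z} → z ∈ thirdsIn x y i → ∃[ β ] β ∈ T i × IsTriple x y z β
  thirdsIn⁻ {x = x} {y} z∈ =
    let (β , β∈ , z∈β) = find (∈-concatMap⁻ (λ β → elements β ∖ x ∖ y) z∈)
    in β , proj₁ (∈-through⁻ β∈) , third⁻ β∈ z∈β

  thirds⁻ : ∀ {x y z} → z ∈ thirds x y → ∃[ i ] ∃[ β ] β ∈ T i × IsTriple x y z β
  thirds⁻ {x} {y} z∈ = let (i , _ , z∈i) = find (∈-concatMap⁻ (thirdsIn x y) {xs = allFin 5} z∈) in i , thirdsIn⁻ z∈i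

  -- A third point determines its block together with `x` and `y`, and disjointness lets that block
  -- lie in one system only.
  thirds-unique : ∀ {x y} → x ≢ y → Unique (thirds x y)
  thirds-unique {x} {y} x≢y = unique-concatMap (Unique.allFin⁺ 5)
    (λ {i} _ → unique-concatMap (Unique.filter⁺ _ (T-unique i))
      (λ {β} _ → unique-∖ (unique-∖ (unique-elements β)))
      (λ β∈ γ∈ z∈β z∈γ → triple-≡ (proj₁ (∈-through⁻ β∈)) (proj₁ (∈-through⁻ γ∈)) x≢y (third⁻ β∈ z∈β) (third⁻ γ∈ z∈γ)))
    (λ {i} {j} _ _ z∈i z∈j → same i j (thirdsIn⁻ z∈i) (thirdsIn⁻ z∈j))
    where
    same : ∀ {z} i j → ∃[ β ] β ∈ T i × IsTriple x y z β → ∃[ γ ] γ ∈ T j × IsTriple x y z γ → i ≡ j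
    same i j (β , β∈T , s) (γ , γ∈T , t) with refl ← triple-≡ β∈T γ∈T x≢y s t = T-disjoint β∈T γ∈T

  -- Each block through the pair leaves one third point, and by balance all five systems have
  -- equally many such blocks.
  thirds-length : ∀ {x y} → x ≢ y → ∀ i → length (thirds x y) ≡ 5 * occ (pair x y) (T i)
  thirds-length {x} {y} x≢y i = length-concatMap (thirdsIn x y) (allFin 5) λ {j} _ →
    trans (length-concatMap _ (through j x y) λ β∈ →
             let (β∈T , x∈β , y∈β) = ∈-through⁻ β∈ in length-elements-∖∖ (T-size _ β∈T) x∈β y∈β x≢y)
          (trans (*-identityʳ _) (occ-≡ x≢y j i))

  thirds-≥5 : ∀ {i x y} → x ≢ y → Joint i x y → 5 ≤ length (thirds x y)
  thirds-≥5 {i} x≢y xy = ≤-trans (*-monoʳ-≤ 5 (joint⇒occ xy)) (≤-reflexive (sym (thirds-length x≢y i)))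

  third-point : ∀ {i x y β} → x ≢ y → β ∈ T i → x ∈ˢ β → y ∈ˢ β → ∃[ z ] IsTriple x y z β
  third-point x≢y β∈T x∈β y∈β =
    let (z , z∈) = inhabited (≤-reflexive (sym (length-elements-∖∖ (T-size _ β∈T) x∈β y∈β x≢y)))
    in z , third⁻ (∈-through⁺ β∈T x∈β y∈β) z∈

  second-point : ∀ {i x β} → β ∈ T i → x ∈ˢ β → ∃[ y ] x ≢ y × y ∈ˢ β
  second-point {β = β} β∈T x∈β =
    let (y , y∈) = inhabited (≤-trans (s≤s z≤n) (≤-reflexive (sym (length-elements-∖ (T-size _ β∈T) x∈β))))
        (y∈β , y≢x) = ∈-∖⁻ (elements β) y∈
    in y , ≢-sym y≢x , ∈-elements⁻ y∈β

-- From a trade to the search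

IsLinear : ∀ {v} → (Fin 5 → List (Subset v)) → Set
IsLinear T = ∀ {i x y β γ} → x ≢ y → β ∈ T i → γ ∈ T i → x ∈ˢ β → y ∈ˢ β → x ∈ˢ γ → y ∈ˢ γ → β ≡ γ

-- The map `e` places the graph's vertices among the points. Every edge is covered in every system
-- by `joined`, and `closed` says that covered pairs never leave the graph.
module Configuration
  {v : ℕ} {T : Fin 5 → List (Subset v)} (trade : IsMuWayTrade 5 v 3 2 T) (linear : IsLinear T)
  {n : ℕ} {e : Fin n → Fin v} (e-injective : ∀ {p q} → e p ≡ e q → p ≡ q) (adj : Fin n → Fin n → Bool)
  (joined : ∀ {p q} → p ≢ q → Bool.T (adj p q) → ∀ i → Trade.Joint T trade i (e p) (e q))
  (closed : ∀ i {p z} → e p ≢ z → Trade.Joint T trade i (e p) z → ∃[ q ] z ≡ e q × Bool.T (adj p q))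
  where
  open Trade T trade
  open Blocks n

  ⟦_⟧ : Atom → Set
  ⟦ i , ps ⟧ = Unique ps × length ps ≡ 3 × ∃[ β ] β ∈ T i × All (λ p → e p ∈ˢ β) ps

  -- Within one system, two shared points force equal blocks by linearity, hence three shared
  -- points. Across two systems, three shared points force equal blocks, against disjointness.
  consistent : ∀ {s t} → ⟦ s ⟧ → ⟦ t ⟧ → ¬ s # t
  consistent {i , ps} {j , qs} (ups , lps , β , β∈T , ps∈β) (uqs , lqs , γ , γ∈T , qs∈γ) = λ where
      (inj₁ (refl , two)) →
        let (p , q , p∈ , q∈ , p≢q) = two-elements ucs (≤-reflexive (sym two))
            β≡γ = linear (p≢q ∘ e-injective) β∈T γ∈T (inβ p∈) (inβ q∈) (inγ p∈) (inγ q∈)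
        in 2≢3 (trans (sym two) (trans (cong length (filter-all _ (All.tabulate (qs⊆ps β≡γ)))) lqs))
      (inj₂ (i≢j , three)) →
        let 3≤ = ≤-reflexive (sym (trans (length-map e cs) three))
            β≡γ = subset-≡ (Unique.map⁺ e-injective ucs)
                    (All.map⁺ (All.tabulate inβ)) (All.map⁺ (All.tabulate inγ))
                    (≤-trans (≤-reflexive (T-size β β∈T)) 3≤) (≤-trans (≤-reflexive (T-size γ γ∈T)) 3≤)
        in i≢j (T-disjoint β∈T (subst (_∈ T j) (sym β≡γ) γ∈T))
    where
    cs = common ps qs
    ucs : Unique cs
    ucs = Unique.filter⁺ _ uqs
    inβ : ∀ {p} → p ∈ cs → e p ∈ˢ β
    inβ p∈ = All.lookup ps∈β (proj₂ (∈-filter⁻ _ {xs = qs} p∈))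
    inγ : ∀ {p} → p ∈ cs → e p ∈ˢ γ
    inγ p∈ = All.lookup qs∈γ (proj₁ (∈-filter⁻ _ {xs = qs} p∈))
    2≢3 : 2 ≢ 3
    2≢3 ()
    qs⊆ps : β ≡ γ → ∀ {q} → q ∈ qs → q ∈ ps
    qs⊆ps refl {q} q∈ =
      let eq∈ = elements-⊆ (Unique.map⁺ e-injective ups) (All.map⁺ ps∈β)
                  (≤-reflexive (trans (T-size β β∈T) (sym (trans (length-map e ps) lps))))
                  (∈-elements⁺ (All.lookup qs∈γ q∈))
          (p , p∈ , eq≡ep) = ∈-map⁻ e eq∈
      in subst (_∈ ps) (sym (e-injective eq≡ep)) p∈

  -- The third point is joined to both ends of the edge, so `closed` names it twice; injectivity of
  -- `e` identifies the two names.
  clause-holds : ∀ i {p q} → p ≢ q → Bool.T (adj p q) → Any ⟦_⟧ (clause adj i (p , q))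
  clause-holds i {p} {q} p≢q pq =
    let ep≢eq = p≢q ∘ e-injective
        (β , β∈T , p∈β , q∈β) = joined p≢q pq i
        (z , t) = third-point ep≢eq β∈T p∈β q∈β
        open IsTriple t
        (r , z≡er , pr) = closed i (≢-sym z≢x) (β , β∈T , p∈β , z∈)
        (s , z≡es , qs) = closed i (≢-sym z≢y) (β , β∈T , q∈β , z∈)
        s≡r = e-injective (trans (sym z≡es) z≡er)
        r≢p = λ r≡p → z≢x (trans z≡er (cong e r≡p))
        r≢q = λ r≡q → z≢y (trans z≡er (cong e r≡q))
    in Any.map⁺ (lose (∈-filter⁺ (completes? adj p q) (∈-allFin r)
                        (r≢p , r≢q , pr , subst (Bool.T ∘ adj q) s≡r qs))
         ( (p≢q ∷ ≢-sym r≢p ∷ []) ∷ (≢-sym r≢q ∷ []) ∷ [] ∷ [] , refl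
         , β , β∈T , p∈β ∷ q∈β ∷ subst (_∈ˢ β) z≡er z∈ ∷ []))

  clauses-hold : ∀ is → All (Any ⟦_⟧) (clauses adj is)
  clauses-hold is = All.concat⁺ (All.map⁺ (All.universal (λ i → All.map⁺ (All.tabulate λ pq∈ →
    let (_ , p<q , pq) = ∈-filter⁻ (uncurry (edge? adj)) {xs = cartesianProduct (allFin n) (allFin n)} pq∈
    in clause-holds i (Fin.<⇒≢ p<q) pq)) is))

  refuted : ∀ {given is} → Refutation adj given is → ¬ All ⟦_⟧ given
  refuted {is = is} r holds = refutes-sound consistent 100 _ (Refutation.search r)
    (All.++⁺ (All.map⁺ (All.map here holds)) (clauses-hold is))

-- Linearity and a point of degree three

module Small {v : ℕ} (T : Fin 5 → List (Subset v)) (trade : IsMuWayTrade 5 v 3 2 T)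
             (i₀ : Fin 5) (small : length (T i₀) ≤ 11) where
  open Trade T trade
  open IsTriple
  open DecList (Fin._≟_ {v})
  open DecMembership (Fin._≟_ {v}) using (_∈?_)

  T₀ : List (Subset v)
  T₀ = T i₀

  deg : Fin v → ℕ
  deg x = degree x T₀

  mass : ∀ {xs} → Unique xs → weight T₀ xs ≤ 33
  mass u = ≤-trans (weight-≤ T₀ u T-size) (*-monoˡ-≤ 3 small)

  Active : Fin v → Set
  Active x = ∃[ β ] β ∈ T₀ × x ∈ˢ β

  -- Read off from `T₀` alone, but by `transfer` it gives the neighbours in every system. Its length
  -- is twice the degree even before linearity excludes repetitions.
  Nb : Fin v → List (Fin v)
  Nb x = concatMap (λ β → elements β ∖ x) (filter (x ∈ˢ?_) T₀)

  Nb⁺ : ∀ {i x y} → x ≢ y → Joint i x y → y ∈ Nb x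
  Nb⁺ {x = x} x≢y xy = let (β , β∈T , x∈β , y∈β) = transfer x≢y xy i₀ in
    ∈-concatMap⁺ (λ β → elements β ∖ x) (lose (∈-filter⁺ (x ∈ˢ?_) β∈T x∈β) (∈-∖⁺ (∈-elements⁺ y∈β) (≢-sym x≢y)))

  ∈-star : ∀ {x y β} → β ∈ filter (x ∈ˢ?_) T₀ → y ∈ elements β ∖ x → x ≢ y × β ∈ T₀ × x ∈ˢ β × y ∈ˢ β
  ∈-star {x} {y} {β} β∈ y∈ =
    let (β∈T , x∈β) = ∈-filter⁻ (x ∈ˢ?_) {xs = T₀} β∈
        (y∈β , y≢x) = ∈-∖⁻ (elements β) y∈
    in ≢-sym y≢x , β∈T , x∈β , ∈-elements⁻ y∈β

  Nb⁻ : ∀ {x y} → y ∈ Nb x → x ≢ y × (∀ i → Joint i x y)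
  Nb⁻ {x} y∈ =
    let (β , β∈ , y∈β) = find (∈-concatMap⁻ (λ β → elements β ∖ x) {xs = filter (x ∈ˢ?_) T₀} y∈)
        (x≢y , xy) = ∈-star β∈ y∈β
    in x≢y , transfer {i₀} x≢y (β , xy)

  Nb-sym : ∀ {x y} → y ∈ Nb x → x ∈ Nb y
  Nb-sym y∈ = let (x≢y , xy) = Nb⁻ y∈
                  (β , β∈T , x∈β , y∈β) = xy i₀
              in Nb⁺ (≢-sym x≢y) (β , β∈T , y∈β , x∈β)

  Nb-irrefl : ∀ {x} → x ∉ Nb x
  Nb-irrefl x∈ = proj₁ (Nb⁻ x∈) refl

  Nb-active : ∀ {x y} → y ∈ Nb x → Active y
  Nb-active y∈ = let (β , β∈T , _ , y∈β) = proj₂ (Nb⁻ y∈) i₀ in β , β∈T , y∈β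

  Nb-length : ∀ x → length (Nb x) ≡ deg x * 2
  Nb-length x = length-concatMap (λ β → elements β ∖ x) (filter (x ∈ˢ?_) T₀) λ {β} β∈ →
    let (β∈T , x∈β) = ∈-filter⁻ (x ∈ˢ?_) {xs = T₀} β∈ in length-elements-∖ (T-size β β∈T) x∈β

  thirds⊆Nb : ∀ {x y} → thirds x y ⊆ Nb x
  thirds⊆Nb w∈ = let (i , β , β∈T , t) = thirds⁻ w∈ in Nb⁺ (≢-sym (z≢x t)) (β , β∈T , x∈ t , z∈ t)

  x∉thirds : ∀ {x y} → x ∉ thirds x y
  x∉thirds x∈ = let (_ , _ , _ , t) = thirds⁻ x∈ in z≢x t refl

  y∉thirds : ∀ {x y} → y ∉ thirds x y
  y∉thirds y∈ = let (_ , _ , _ , t) = thirds⁻ y∈ in z≢y t refl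

  -- A covered pair `x`, `y` has at least five third points, and with `y` they give six distinct
  -- neighbours of `x`.
  deg-≥3 : ∀ {x} → Active x → 3 ≤ deg x
  deg-≥3 {x} (β , β∈T , x∈β) =
    let (y , x≢y , y∈β) = second-point β∈T x∈β
        xy = β , β∈T , x∈β , y∈β
    in half-≤ (begin
         6                       ≤⟨ s≤s (thirds-≥5 x≢y xy) ⟩
         length (y ∷ thirds x y) ≤⟨ pigeonhole (unique-∷ y∉thirds (thirds-unique x≢y))
                                      (λ { (here refl) → Nb⁺ x≢y xy ; (there z∈) → thirds⊆Nb z∈ }) ⟩
         length (Nb x)           ≡⟨ Nb-length x ⟩
         deg x * 2               ∎)
    where open ≤-Reasoning

  active-≤11 : ∀ {xs} → Unique xs → All Active xs → length xs ≤ 11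
  active-≤11 {xs} u as = *-cancelʳ-≤ (length xs) 11 3 (≤-trans (weight-≥ T₀ (All.map deg-≥3 as)) (mass u))

  -- Two blocks through the pair would give ten third points; with `x` and `y` that is twelve
  -- covered points, against `active-≤11`.
  occ-≤1 : ∀ {x y} → x ≢ y → ∀ i → occ (pair x y) (T i) ≤ 1
  occ-≤1 {x} {y} x≢y i = ≮⇒≥ λ 2≤occ →
    let xy = transfer {i} {x} {y} x≢y (occ⇒joint (≤-trans (s≤s z≤n) 2≤occ)) i₀
        (β , β∈T , x∈β , y∈β) = xy
    in 1+n≰n (≤-trans
      (s≤s (s≤s (≤-trans (*-monoʳ-≤ 5 2≤occ) (≤-reflexive (sym (thirds-length x≢y i))))))
      (active-≤11
        (unique-∷ (λ { (here x≡y) → x≢y x≡y ; (there x∈) → x∉thirds x∈ }) (unique-∷ y∉thirds (thirds-unique x≢y)))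
        ((β , β∈T , x∈β) ∷ (β , β∈T , y∈β) ∷ All.tabulate (Nb-active ∘ thirds⊆Nb))))

  linear : IsLinear T
  linear {i} x≢y β∈T γ∈T x∈β y∈β x∈γ y∈γ =
    single (occ-≤1 x≢y i) (∈-through⁺ β∈T x∈β y∈β) (∈-through⁺ γ∈T x∈γ y∈γ)
    where
    single : ∀ {β γ} {βs : List (Subset v)} → length βs ≤ 1 → β ∈ βs → γ ∈ βs → β ≡ γ
    single _ (here refl) (here refl) = refl
    single {βs = _ ∷ _ ∷ _} (s≤s ()) _ (there _)
    single {βs = _ ∷ _ ∷ _} (s≤s ()) (there _) _

  Nb-unique : ∀ x → Unique (Nb x)
  Nb-unique x = unique-concatMap (Unique.filter⁺ _ (T-unique i₀))
    (λ {β} _ → unique-∖ (unique-elements β))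
    λ β∈ γ∈ y∈β y∈γ →
      let (x≢y , β∈T , x∈β , y∈β′) = ∈-star β∈ y∈β
          (_ , γ∈T , x∈γ , y∈γ′) = ∈-star γ∈ y∈γ
      in linear x≢y β∈T γ∈T x∈β y∈β′ x∈γ y∈γ′

  closed-Nb-unique : ∀ x → Unique (x ∷ Nb x)
  closed-Nb-unique x = unique-∷ Nb-irrefl (Nb-unique x)

  -- If `x` and all its neighbours had degree at least 4, these would be at least 1 + 8 points of
  -- total weight at least 36, exceeding 33.
  light-from : ∀ {x} → Active x → ∃[ y ] Active y × deg y ≡ 3
  light-from {x} ax with All.all? (λ y → 4 ≤? deg y) (x ∷ Nb x)
  ... | yes heavy = contradiction
        (≤-trans (*-monoˡ-≤ 4 (s≤s (≤-trans (*-monoˡ-≤ 2 (All.head heavy)) (≤-reflexive (sym (Nb-length x))))))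
          (≤-trans (weight-≥ T₀ heavy) (mass (closed-Nb-unique x))))
        (<⇒≱ (m≤m+n 34 2))
  ... | no ¬heavy =
    let (y , y∈ , ¬4≤) = find (All.¬All⇒Any¬ (λ y → 4 ≤? deg y) _ ¬heavy)
        ay = All.lookup {P = Active} (ax ∷ All.tabulate Nb-active) y∈
    in y , ay , ≤-antisym (≮⇒≥ ¬4≤) (deg-≥3 ay)

  light-point : ∃[ x ] Active x × deg x ≡ 3
  light-point =
    let (β , β∈T) = nonempty (T-nonempty i₀)
        (x , x∈β) = inhabited (≤-trans (s≤s z≤n) (≤-reflexive (sym (trans (length-elements β) (T-size β β∈T)))))
    in light-from (β , β∈T , ∈-elements⁻ x∈β)
    where
    nonempty : ∀ {βs : List (Subset v)} → βs ≢ [] → ∃[ β ] β ∈ βs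
    nonempty {[]} h = contradiction refl h
    nonempty {β ∷ _} _ = β , here refl

-- Arithmetic of the weight bound

private
  -- For a point outside `S`, `i` and `o` count its neighbours inside and outside `S`, and `k` the
  -- rest of `S`. The weights are 4 on the first kind, 3 on the others and 3 on the point itself.
  -- The inequalities give 2i ≥ 42 - 33 = 9, and parity gives 5.
  many-inside : ∀ i k o → 7 ≤ i + k → 6 ≤ i + o → i * 4 + (k * 3 + (3 + o * 3)) ≤ 33 → 5 ≤ i
  many-inside i k o ik io h = odd-half-≤ {4} (+-cancelʳ-≤ 33 9 (i * 2) (begin
    42                                           ≤⟨ +-mono-≤ (*-monoˡ-≤ 3 ik) (+-monoʳ-≤ 3 (*-monoˡ-≤ 3 io)) ⟩
    (i + k) * 3 + (3 + (i + o) * 3)              ≡⟨ regroup i k o ⟩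
    i * 2 + (i * 4 + (k * 3 + (3 + o * 3)))      ≤⟨ +-monoʳ-≤ (i * 2) h ⟩
    i * 2 + 33                                   ∎))
    where
    open ≤-Reasoning
    regroup : ∀ i k o → (i + k) * 3 + (3 + (i + o) * 3) ≡ i * 2 + (i * 4 + (k * 3 + (3 + o * 3)))
    regroup = solve-∀

  -- The 9 is the least weight of three points outside `S`; the total then exceeds 33.
  too-heavy : ∀ i k → 5 ≤ i → 7 ≤ i + k → 35 ≤ i * 4 + (k * 3 + 9)
  too-heavy i k i≥5 ik = begin
    35                   ≤⟨ +-mono-≤ i≥5 (+-monoˡ-≤ 9 (*-monoˡ-≤ 3 ik)) ⟩
    i + ((i + k) * 3 + 9) ≡⟨ regroup i k ⟩
    i * 4 + (k * 3 + 9)  ∎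
    where
    open ≤-Reasoning
    regroup : ∀ i k → i + ((i + k) * 3 + 9) ≡ i * 4 + (k * 3 + 9)
    regroup = solve-∀

-- The clique around a point of degree three

module Light {v : ℕ} (T : Fin 5 → List (Subset v)) (trade : IsMuWayTrade 5 v 3 2 T)
             (i₀ : Fin 5) (small : length (T i₀) ≤ 11)
             {x : Fin v} (x-active : Small.Active T trade i₀ small x) (x-light : Small.deg T trade i₀ small x ≡ 3) where
  open Small T trade i₀ small
  open Trade T trade
  open IsTriple
  open DecList (Fin._≟_ {v})
  open DecMembership (Fin._≟_ {v}) using (_∈?_; _∉?_)

  N S : List (Fin v)
  N = Nb x
  S = x ∷ N

  N-length : length N ≡ 6
  N-length = trans (Nb-length x) (cong (_* 2) x-light)

  S-unique : Unique S
  S-unique = closed-Nb-unique x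

  S-active : All Active S
  S-active = x-active ∷ All.tabulate Nb-active

  S∖-length : ∀ {s} → s ∈ S → length (S ∖ s) ≡ 6
  S∖-length s∈S = suc-injective (trans (sym (length-∖ S-unique s∈S)) (cong suc N-length))

  -- The five third points of the pair xy are distinct, so they exhaust N ∖ y.
  triangle : ∀ {y z} → y ∈ N → z ∈ N → y ≢ z → ∃[ i ] ∃[ β ] β ∈ T i × IsTriple x y z β
  triangle {y} {z} y∈N z∈N y≢z =
    let (x≢y , xy) = Nb⁻ y∈N
        z∈thirds = saturated (thirds-unique x≢y)
          (λ w∈ → ∈-∖⁺ (thirds⊆Nb w∈) λ { refl → y∉thirds w∈ })
          (≤-trans (≤-reflexive (suc-injective (trans (sym (length-∖ (Nb-unique x) y∈N)) N-length)))
                   (thirds-≥5 x≢y (xy i₀)))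
          (∈-∖⁺ z∈N (≢-sym y≢z))
    in thirds⁻ z∈thirds

  -- For two points of `N`, the block with `x` supplied by `triangle` also joins them to each other.
  clique : ∀ {y z} → y ∈ S → z ∈ S → y ≢ z → z ∈ Nb y
  clique (here refl) (here refl) y≢z = contradiction refl y≢z
  clique (here refl) (there z∈N) _ = z∈N
  clique (there y∈N) (here refl) _ = Nb-sym y∈N
  clique (there y∈N) (there z∈N) y≢z =
    let (_ , β , β∈T , t) = triangle y∈N z∈N y≢z in Nb⁺ y≢z (β , β∈T , y∈ t , z∈ t)

  -- Symmetry breaking for the search: after renumbering by `σ`, the block of system `j` through `x`
  -- and `y` is known in advance.
  record Relabelling (y : Fin v) (f : Fin 5 → Fin v) : Set where
    field
      σ           : Fin 5 → Fin 5
      σ-injective : ∀ {j k} → σ j ≡ σ k → j ≡ k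
      block       : ∀ j → ∃[ β ] β ∈ T (σ j) × IsTriple x y (f j) β

    trade-σ : IsMuWayTrade 5 v 3 2 (T ∘ σ)
    trade-σ j k j≢k = trade (σ j) (σ k) (j≢k ∘ σ-injective)

  -- `σ j` is the system containing the triple on `x`, `y`, `f j`. If two indices shared a system,
  -- linearity would merge their blocks and hence their third points.
  relabel : ∀ {y f} → y ∈ N → (∀ j → f j ∈ N) → (∀ {j k} → f j ≡ f k → j ≡ k) → (∀ j → y ≢ f j) → Relabelling y f
  relabel {y} {f} y∈N f∈N f-injective y≢f = record
    { σ = proj₁ ∘ tri
    ; σ-injective = λ {j} {k} eq →
        let (β , β∈T , s) = proj₂ (tri j)
            (γ , γ∈T , t) = proj₂ (tri k)
            β≡γ = linear x≢y β∈T (subst (λ i → γ ∈ T i) (sym eq) γ∈T) (x∈ s) (y∈ s) (x∈ t) (y∈ t)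
            fk∈ = elements-⊆ ((x≢y ∷ ≢-sym (z≢x s) ∷ []) ∷ (≢-sym (z≢y s) ∷ []) ∷ [] ∷ [])
                    (x∈ s ∷ y∈ s ∷ z∈ s ∷ []) (≤-reflexive (T-size β β∈T))
                    (∈-elements⁺ (subst (f k ∈ˢ_) (sym β≡γ) (z∈ t)))
        in case fk∈ of λ where
             (here fk≡x) → contradiction fk≡x (z≢x t)
             (there (here fk≡y)) → contradiction fk≡y (z≢y t)
             (there (there (here fk≡fj))) → f-injective (sym fk≡fj)
    ; block = proj₂ ∘ tri
    }
    where
    x≢y = proj₁ (Nb⁻ y∈N)
    tri : ∀ j → ∃[ i ] ∃[ β ] β ∈ T i × IsTriple x y (f j) β
    tri j = triangle y∈N (f∈N j) (y≢f j)

  -- Each point of `S` has the six others as neighbours, and degree at most 3 leaves room for no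
  -- more. So every block meeting `S` lies in `S`.
  K₇-impossible : ¬ All (λ s → deg s ≤ 3) S
  K₇-impossible light = refute (relabel (∈-lookup _) (λ j → ∈-lookup _)
      (λ {j} {k} h → Fin.suc-injective (Fin.suc-injective (at-inj {suc (suc j)} {suc (suc k)} h)))
      (λ j h → case at-inj {1F} {suc (suc j)} h of λ ()))
    where
    open Enumeration S (cong suc N-length)
    at-inj : ∀ {p q} → at p ≡ at q → p ≡ q
    at-inj = at-injective S-unique

    refute : ¬ Relabelling (at 1F) (λ j → at (suc (suc j)))
    refute r = refuted K₇-refutation (All.map⁺ {f = K₇-given} (All.universal holds (allFin 5)))
      where
      open Relabelling r
      joined : ∀ {p q} → p ≢ q → Bool.T true → ∀ i → Joint (σ i) (at p) (at q)
      joined {p} {q} p≢q _ i = proj₂ (Nb⁻ (clique (at-∈ p) (at-∈ q) (p≢q ∘ at-inj))) (σ i)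
      closed : ∀ i {p z} → at p ≢ z → Joint (σ i) (at p) z → ∃[ q ] z ≡ at q × Bool.T true
      closed i {p} p≢z pz =
        let z∈ = saturated (unique-∖ S-unique)
                   (λ w∈ → let (w∈S , w≢p) = ∈-∖⁻ S w∈ in clique (at-∈ p) w∈S (≢-sym w≢p))
                   (≤-trans (≤-reflexive (Nb-length (at p)))
                     (≤-trans (*-monoˡ-≤ 2 (All.lookup light (at-∈ p))) (≤-reflexive (sym (S∖-length (at-∈ p))))))
                   (Nb⁺ {σ i} p≢z pz)
            (q , z≡) = ∈⇒at (proj₁ (∈-∖⁻ S z∈))
        in q , z≡ , tt
      open Configuration trade-σ linear {e = at} at-inj K₇-adj joined closed
      holds : ∀ j → ⟦ K₇-given j ⟧
      holds j = let (β , β∈T , t) = block j in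
        ((λ ()) ∷ (λ ()) ∷ []) ∷ ((λ ()) ∷ []) ∷ [] ∷ [] , refl , β , β∈T , x∈ t ∷ y∈ t ∷ z∈ t ∷ []

  ∈S∖ : ∀ {s z} → s ∈ S → z ∈ S ∖ s → z ∈ Nb s
  ∈S∖ s∈S z∈ = let (z∈S , z≢s) = ∈-∖⁻ S z∈ in clique s∈S z∈S (≢-sym z≢s)

  -- The six other points of `S` and `o` are seven neighbours, and the number of neighbours is even.
  heavy-inside : ∀ {s o} → s ∈ S → o ∉ S → o ∈ Nb s → 4 ≤ deg s
  heavy-inside {s} {o} s∈S o∉S o∈ = odd-half-≤ {3} (begin
    7                      ≡⟨ cong suc (sym (S∖-length s∈S)) ⟩
    length (o ∷ (S ∖ s))   ≤⟨ pigeonhole (unique-∷ (o∉S ∘ proj₁ ∘ ∈-∖⁻ S) (unique-∖ S-unique))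
                                (λ { (here refl) → o∈ ; (there z∈) → ∈S∖ s∈S z∈ }) ⟩
    length (Nb s)          ≡⟨ Nb-length s ⟩
    deg s * 2              ∎)
    where open ≤-Reasoning

  -- Of at least eight neighbours only six can lie in `S`.
  two-outside : ∀ {s} → s ∈ S → 4 ≤ deg s → ∃[ o ] ∃[ o′ ] (o ∈ Nb s × o ∉ S) × (o′ ∈ Nb s × o′ ∉ S) × o ≢ o′
  two-outside {s} s∈S 4≤ =
    let (o , o′ , o∈ , o′∈ , o≢o′) = two-elements (Unique.filter⁺ (_∉? S) (Nb-unique s)) (+-cancelˡ-≤ 6 2 _ (begin
          8                                ≤⟨ *-monoˡ-≤ 2 4≤ ⟩
          deg s * 2                        ≡⟨ Nb-length s ⟨
          length (Nb s)                    ≤⟨ pigeonhole (Nb-unique s) cover ⟩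
          length ((S ∖ s) ++ outside-S)    ≡⟨ length-++ (S ∖ s) ⟩
          length (S ∖ s) + length outside-S ≡⟨ cong (_+ length outside-S) (S∖-length s∈S) ⟩
          6 + length outside-S             ∎))
    in o , o′ , ∈-filter⁻ (_∉? S) {xs = Nb s} o∈ , ∈-filter⁻ (_∉? S) {xs = Nb s} o′∈ , o≢o′
    where
    open ≤-Reasoning
    outside-S = filter (_∉? S) (Nb s)
    cover : Nb s ⊆ (S ∖ s) ++ outside-S
    cover {z} z∈ with z ∈? S
    ... | yes z∈S = ∈-++⁺ˡ (∈-∖⁺ z∈S λ { refl → Nb-irrefl z∈ })
    ... | no z∉S = ∈-++⁺ʳ (S ∖ s) (∈-filter⁺ (_∉? S) z∈ z∉S)

  -- Covered points outside the clique

  module Outside {o : Fin v} (o-active : Active o) (o∉S : o ∉ S) where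

    I K O : List (Fin v)
    I = filter (_∈? S) (Nb o)
    K = filter (_∉? I) S
    O = filter (_∉? S) (Nb o)

    I⊆S : I ⊆ S
    I⊆S = proj₂ ∘ ∈-filter⁻ (_∈? S) {xs = Nb o}

    K⊆S : K ⊆ S
    K⊆S = proj₁ ∘ ∈-filter⁻ (_∉? I) {xs = S}

    IK-unique : ∀ {zs} → Unique zs → (∀ {z} → z ∈ zs → z ∉ S) → Unique (I ++ K ++ zs)
    IK-unique u zs∉S = Unique.++⁺ (Unique.filter⁺ _ (Nb-unique o))
      (Unique.++⁺ (Unique.filter⁺ (_∉? I) S-unique) u (λ (z∈K , z∈zs) → zs∉S z∈zs (K⊆S z∈K)))
      λ (z∈I , z∈) → [ (λ z∈K → proj₂ (∈-filter⁻ (_∉? I) {xs = S} z∈K) z∈I)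
                     , (λ z∈zs → zs∉S z∈zs (I⊆S z∈I)) ]′ (∈-++⁻ K z∈)

    IK-weight : ∀ {zs} → Unique zs → (∀ {z} → z ∈ zs → z ∉ S) → All Active zs →
      length I * 4 + (length K * 3 + length zs * 3) ≤ 33
    IK-weight {zs} u zs∉S as = begin
      length I * 4 + (length K * 3 + length zs * 3)
        ≤⟨ +-mono-≤ (weight-≥ T₀ (All.tabulate λ s∈I →
               heavy-inside (I⊆S s∈I) o∉S (Nb-sym (proj₁ (∈-filter⁻ (_∈? S) {xs = Nb o} s∈I)))))
             (+-mono-≤ (weight-≥ T₀ (All.tabulate (deg-≥3 ∘ All.lookup S-active ∘ K⊆S)))
                       (weight-≥ T₀ (All.map deg-≥3 as))) ⟩
      weight T₀ I + (weight T₀ K + weight T₀ zs)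
        ≡⟨ trans (weight-++ T₀ I (K ++ zs)) (cong (weight T₀ I +_) (weight-++ T₀ K zs)) ⟨
      weight T₀ (I ++ K ++ zs)
        ≤⟨ mass (IK-unique u zs∉S) ⟩
      33 ∎
      where open ≤-Reasoning

    IK-length : 7 ≤ length I + length K
    IK-length = begin
      7                   ≡⟨ cong suc N-length ⟨
      length S            ≤⟨ pigeonhole S-unique cover ⟩
      length (I ++ K)     ≡⟨ length-++ I ⟩
      length I + length K ∎
      where
      open ≤-Reasoning
      cover : S ⊆ I ++ K
      cover {z} z∈S with z ∈? I
      ... | yes z∈I = ∈-++⁺ˡ z∈I
      ... | no z∉I = ∈-++⁺ʳ I (∈-filter⁺ (_∉? I) z∈S z∉I)

    IO-length : 6 ≤ length I + length O
    IO-length = begin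
      6                   ≤⟨ *-monoˡ-≤ 2 (deg-≥3 o-active) ⟩
      deg o * 2           ≡⟨ Nb-length o ⟨
      length (Nb o)       ≤⟨ pigeonhole (Nb-unique o) cover ⟩
      length (I ++ O)     ≡⟨ length-++ I ⟩
      length I + length O ∎
      where
      open ≤-Reasoning
      cover : Nb o ⊆ I ++ O
      cover {z} z∈ with z ∈? S
      ... | yes z∈S = ∈-++⁺ˡ (∈-filter⁺ (_∈? S) z∈ z∈S)
      ... | no z∉S = ∈-++⁺ʳ I (∈-filter⁺ (_∉? S) z∈ z∉S)

    -- The weight bound is applied to all of `S` together with `o` and its neighbours outside `S`.
    I-length : 5 ≤ length I
    I-length = many-inside (length I) (length K) (length O) IK-length IO-length
      (IK-weight {o ∷ O}
        (unique-∷ (Nb-irrefl ∘ proj₁ ∘ ∈-filter⁻ (_∉? S) {xs = Nb o}) (Unique.filter⁺ _ (Nb-unique o)))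
        (λ { (here refl) → o∉S ; (there z∈O) → proj₂ (∈-filter⁻ (_∉? S) {xs = Nb o} z∈O) })
        (o-active ∷ All.tabulate (Nb-active ∘ proj₁ ∘ ∈-filter⁻ (_∉? S) {xs = Nb o})))

    -- At least five points of `S` are joined to `o` and hence have degree at least 4, which leaves
    -- too little weight for three outside points.
    no-three-outside : ∀ {p q} → Active p → Active q → p ∉ S → q ∉ S → o ≢ p → o ≢ q → p ≢ q → ⊥
    no-three-outside {p} {q} ap aq p∉S q∉S o≢p o≢q p≢q = contradiction
      (≤-trans (too-heavy (length I) (length K) I-length IK-length)
        (IK-weight {o ∷ p ∷ q ∷ []} ((o≢p ∷ o≢q ∷ []) ∷ (p≢q ∷ []) ∷ [] ∷ [])
          (λ { (here refl) → o∉S ; (there (here refl)) → p∉S ; (there (there (here refl))) → q∉S })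
          (o-active ∷ ap ∷ aq ∷ [])))
      (<⇒≱ (m≤m+n 34 1))

  -- The two graphs on nine points

  module NinePoints {o o′ : Fin v} (o-active : Active o) (o′-active : Active o′)
                    (o∉S : o ∉ S) (o′∉S : o′ ∉ S) (o≢o′ : o ≢ o′) where

    -- The order matches the vertices of `K₉-K₃-adj`.
    F : List (Fin v)
    F = x ∷ o ∷ o′ ∷ N

    F-unique : Unique F
    F-unique =
      unique-∷ (λ { (here refl) → o∉S (here refl) ; (there (here refl)) → o′∉S (here refl) ; (there (there x∈N)) → Nb-irrefl x∈N })
        (unique-∷ (λ { (here o≡o′) → o≢o′ o≡o′ ; (there o∈N) → o∉S (there o∈N) })
          (unique-∷ (o′∉S ∘ there) (Nb-unique x)))

    F-length : length F ≡ 9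
    F-length = cong (3 +_) N-length

    S⊆F : S ⊆ F
    S⊆F (here refl) = here refl
    S⊆F (there z∈N) = there (there (there z∈N))

    F-complete : ∀ {z} → Active z → z ∈ F
    F-complete {z} az with z ∈? S | z Fin.≟ o | z Fin.≟ o′
    ... | yes z∈S | _ | _ = S⊆F z∈S
    ... | no _ | yes refl | _ = there (here refl)
    ... | no _ | no _ | yes refl = there (there (here refl))
    ... | no z∉S | no z≢o | no z≢o′ =
      ⊥-elim (Outside.no-three-outside o-active o∉S o′-active az o′∉S z∉S o≢o′ (≢-sym z≢o) (≢-sym z≢o′))

    Nb-F : ∀ {y z} → z ∈ Nb y → z ∈ F
    Nb-F = F-complete ∘ Nb-active

    -- All neighbours of `x` lie in `S` by its definition.
    x∉Nb-o : x ∉ Nb o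
    x∉Nb-o = o∉S ∘ there ∘ Nb-sym

    x∉Nb-o′ : x ∉ Nb o′
    x∉Nb-o′ = o′∉S ∘ there ∘ Nb-sym

    Nb-o⊆ : Nb o ⊆ o′ ∷ N
    Nb-o⊆ z∈ with Nb-F z∈
    ... | here refl = contradiction z∈ x∉Nb-o
    ... | there (here refl) = contradiction z∈ Nb-irrefl
    ... | there (there z∈′) = z∈′

    -- The degree 2 · deg o is even and at most 7.
    Nb-o-length : length (Nb o) ≡ 6
    Nb-o-length = trans (Nb-length o) (cong (_* 2) (≤-antisym
      (≮⇒≥ λ 4≤ → contradiction (begin
        8               ≤⟨ *-monoˡ-≤ 2 4≤ ⟩
        deg o * 2       ≡⟨ Nb-length o ⟨
        length (Nb o)   ≤⟨ pigeonhole (Nb-unique o) Nb-o⊆ ⟩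
        length (o′ ∷ N) ≡⟨ cong suc N-length ⟩
        7               ∎) (<⇒≱ ≤-refl))
      (deg-≥3 o-active)))
      where open ≤-Reasoning

    -- A neighbour outside `S` raises the degree to at least 4, and eight neighbours exhaust the
    -- rest of `F`.
    full : ∀ {s p} → s ∈ S → p ∉ S → p ∈ Nb s → ∀ {z} → z ∈ F → z ≢ s → z ∈ Nb s
    full {s} s∈S p∉S p∈ z∈F z≢s = saturated (Nb-unique s)
      (λ w∈ → ∈-∖⁺ (Nb-F w∈) λ { refl → Nb-irrefl w∈ })
      (begin
        length (F ∖ s) ≡⟨ suc-injective (trans (sym (length-∖ F-unique (S⊆F s∈S))) F-length) ⟩
        8              ≤⟨ *-monoˡ-≤ 2 (heavy-inside s∈S p∉S p∈) ⟩
        deg s * 2      ≡⟨ Nb-length s ⟨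
        length (Nb s)  ∎)
      (∈-∖⁺ z∈F z≢s)
      where open ≤-Reasoning

    -- Without `o′`, the six neighbours of `o` are exactly `N`. So every point of `N` is joined to
    -- all of `F`, while `x`, `o`, `o′` are pairwise not joined.
    K₉-K₃-impossible : ¬ (o′ ∉ Nb o)
    K₉-K₃-impossible o′∉ = refute (relabel (∈-lookup _) (λ j → ∈-lookup _)
      (λ {j} {k} h → Fin.suc-injective (Fin.suc-injective (Fin.suc-injective (Fin.suc-injective
        (at-inj {suc (suc (suc (suc j)))} {suc (suc (suc (suc k)))} h)))))
      (λ j h → case at-inj {3F} {suc (suc (suc (suc j)))} h of λ ()))
      where
      open Enumeration F F-length
      at-inj : ∀ {p q} → at p ≡ at q → p ≡ q
      at-inj = at-injective F-unique

      N⊆Nb-o : N ⊆ Nb o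
      N⊆Nb-o = saturated (Nb-unique o)
        (λ z∈ → case Nb-o⊆ z∈ of λ { (here refl) → contradiction z∈ o′∉ ; (there z∈N) → z∈N })
        (≤-reflexive (trans N-length (sym Nb-o-length)))

      universal : ∀ {s} → s ∈ N → ∀ {z} → z ∈ F → z ≢ s → z ∈ Nb s
      universal s∈N = full (there s∈N) o∉S (Nb-sym (N⊆Nb-o s∈N))

      adjacent : ∀ p q → p ≢ q → Bool.T (K₉-K₃-adj p q) → at q ∈ Nb (at p)
      adjacent (suc (suc (suc p))) q p≢q _ = universal (∈-lookup _) (at-∈ q) (p≢q ∘ sym ∘ at-inj)
      adjacent 0F (suc (suc (suc q))) p≢q _ = Nb-sym (universal (∈-lookup _) (at-∈ 0F) (p≢q ∘ at-inj))
      adjacent 1F (suc (suc (suc q))) p≢q _ = Nb-sym (universal (∈-lookup _) (at-∈ 1F) (p≢q ∘ at-inj))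
      adjacent 2F (suc (suc (suc q))) p≢q _ = Nb-sym (universal (∈-lookup _) (at-∈ 2F) (p≢q ∘ at-inj))

      adjacent⁻ : ∀ p q → at q ∈ Nb (at p) → Bool.T (K₉-K₃-adj p q)
      adjacent⁻ (suc (suc (suc p))) q _ = tt
      adjacent⁻ 0F (suc (suc (suc q))) _ = tt
      adjacent⁻ 1F (suc (suc (suc q))) _ = tt
      adjacent⁻ 2F (suc (suc (suc q))) _ = tt
      adjacent⁻ 0F 0F = Nb-irrefl
      adjacent⁻ 1F 1F = Nb-irrefl
      adjacent⁻ 2F 2F = Nb-irrefl
      adjacent⁻ 0F 1F = x∉Nb-o ∘ Nb-sym
      adjacent⁻ 0F 2F = x∉Nb-o′ ∘ Nb-sym
      adjacent⁻ 1F 0F = x∉Nb-o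
      adjacent⁻ 1F 2F = o′∉
      adjacent⁻ 2F 0F = x∉Nb-o′
      adjacent⁻ 2F 1F = o′∉ ∘ Nb-sym

      refute : ¬ Relabelling (at 3F) (λ j → at (suc (suc (suc (suc j)))))
      refute r = refuted K₉-K₃-refutation (All.map⁺ {f = K₉-K₃-given} (All.universal holds (allFin 5)))
        where
        open Relabelling r
        joined : ∀ {p q} → p ≢ q → Bool.T (K₉-K₃-adj p q) → ∀ i → Joint (σ i) (at p) (at q)
        joined {p} {q} p≢q pq i = proj₂ (Nb⁻ (adjacent p q p≢q pq)) (σ i)
        closed : ∀ i {p z} → at p ≢ z → Joint (σ i) (at p) z → ∃[ q ] z ≡ at q × Bool.T (K₉-K₃-adj p q)
        closed i {p} p≢z pz =
          let z∈ = Nb⁺ {σ i} p≢z pz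
              (q , z≡q) = ∈⇒at (Nb-F z∈)
          in q , z≡q , adjacent⁻ p q (subst (_∈ Nb (at p)) z≡q z∈)
        open Configuration trade-σ linear {e = at} at-inj K₉-K₃-adj joined closed
        holds : ∀ j → ⟦ K₉-K₃-given j ⟧
        holds j = let (β , β∈T , t) = block j in
          ((λ ()) ∷ (λ ()) ∷ []) ∷ ((λ ()) ∷ []) ∷ [] ∷ [] , refl , β , β∈T , x∈ t ∷ y∈ t ∷ z∈ t ∷ []

    -- The point `o` has only six neighbours, and `o′` takes one of the places.
    missed : o′ ∈ Nb o → ∃[ s ] s ∈ N × s ∉ Nb o
    missed o′∈ with All.all? (_∈? Nb o) N
    ... | yes N⊆ = contradiction
          (pigeonhole (unique-∷ (o′∉S ∘ there) (Nb-unique x)) λ { (here refl) → o′∈ ; (there z∈N) → All.lookup N⊆ z∈N })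
          (<⇒≱ (≤-reflexive (cong suc (trans Nb-o-length (sym N-length)))))
    ... | no ¬N⊆ = find (All.¬All⇒Any¬ (_∈? Nb o) N ¬N⊆)

    -- Here `o` misses exactly one point `s` of `N`; the non-edges of the graph are the four pairs
    -- between `x`, `s` and `o`, `o′`.
    K₉-K₂₂-impossible : o′ ∉ Nb o
    K₉-K₂₂-impossible o′∈ = refuted K₉-K₂₂-refutation []
      where
      s : Fin v
      s = proj₁ (missed o′∈)
      s∈N : s ∈ N
      s∈N = proj₁ (proj₂ (missed o′∈))
      s∉Nb-o : s ∉ Nb o
      s∉Nb-o = proj₂ (proj₂ (missed o′∈))

      s≢o : s ≢ o
      s≢o s≡o = o∉S (there (subst (_∈ N) s≡o s∈N))
      s≢o′ : s ≢ o′
      s≢o′ s≡o′ = o′∉S (there (subst (_∈ N) s≡o′ s∈N))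

      s∉Nb-o′ : s ∉ Nb o′
      -- Being joined to `o′` would make `s` joined to every other point of `F`, including `o`.
      s∉Nb-o′ s∈ = s∉Nb-o (Nb-sym (full (there s∈N) o′∉S (Nb-sym s∈) (there (here refl)) (≢-sym s≢o)))

      N∖s-length : length (N ∖ s) ≡ 5
      N∖s-length = suc-injective (trans (sym (length-∖ (Nb-unique x) s∈N)) N-length)

      N∖s⊆Nb-o : N ∖ s ⊆ Nb o
      -- Both `Nb o` and the list consisting of `o′` and the five points of `N` other than `s` have
      -- length six.
      N∖s⊆Nb-o z∈ = saturated (Nb-unique o)
        (λ w∈ → case Nb-o⊆ w∈ of λ where
          (here refl) → here refl
          (there w∈N) → there (∈-∖⁺ w∈N λ w≡s → s∉Nb-o (subst (_∈ Nb o) w≡s w∈)))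
        (≤-reflexive (trans (cong suc N∖s-length) (sym Nb-o-length))) (there {x = o′} z∈)

      -- Rearranges `F` with `s` moved forward, to match the vertices of `K₉-K₂₂-adj`.
      G : List (Fin v)
      G = x ∷ s ∷ o ∷ o′ ∷ (N ∖ s)

      G-unique : Unique G
      G-unique =
        unique-∷ (λ { (here x≡s) → Nb-irrefl (subst (_∈ N) (sym x≡s) s∈N) ; (there (here refl)) → o∉S (here refl)
                    ; (there (there (here refl))) → o′∉S (here refl) ; (there (there (there x∈))) → Nb-irrefl (proj₁ (∈-∖⁻ N x∈)) })
        (unique-∷ (λ { (here s≡o) → s≢o s≡o ; (there (here s≡o′)) → s≢o′ s≡o′ ; (there (there s∈)) → proj₂ (∈-∖⁻ N s∈) refl })
        (unique-∷ (λ { (here o≡o′) → o≢o′ o≡o′ ; (there o∈) → o∉S (there (proj₁ (∈-∖⁻ N o∈))) })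
        (unique-∷ (λ o′∈ → o′∉S (there (proj₁ (∈-∖⁻ N o′∈)))) (unique-∖ (Nb-unique x)))))

      F⊆G : F ⊆ G
      F⊆G (here refl) = here refl
      F⊆G (there (here refl)) = there (there (here refl))
      F⊆G (there (there (here refl))) = there (there (there (here refl)))
      F⊆G {z} (there (there (there z∈N))) with z Fin.≟ s
      ... | yes z≡s = there (here z≡s)
      ... | no z≢s = there (there (there (there (∈-∖⁺ z∈N z≢s))))

      G⊆F : G ⊆ F
      G⊆F (here refl) = here refl
      G⊆F (there (here refl)) = there (there (there s∈N))
      G⊆F (there (there (here refl))) = there (here refl)
      G⊆F (there (there (there (here refl)))) = there (there (here refl))
      G⊆F (there (there (there (there z∈)))) = there (there (there (proj₁ (∈-∖⁻ N z∈))))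

      open Enumeration {n = 9} G (cong (4 +_) N∖s-length)
      at-inj : ∀ {p q} → at p ≡ at q → p ≡ q
      at-inj = at-injective G-unique

      universal : ∀ {y} → y ∈ N ∖ s → ∀ {z} → z ∈ G → z ≢ y → z ∈ Nb y
      universal y∈ z∈G = full (there (proj₁ (∈-∖⁻ N y∈))) o∉S (Nb-sym (N∖s⊆Nb-o y∈)) (G⊆F z∈G)

      adjacent : ∀ p q → p ≢ q → Bool.T (K₉-K₂₂-adj p q) → at q ∈ Nb (at p)
      adjacent (suc (suc (suc (suc p)))) q p≢q _ = universal (∈-lookup _) (at-∈ q) (p≢q ∘ sym ∘ at-inj)
      adjacent 0F (suc (suc (suc (suc q)))) p≢q _ = Nb-sym (universal (∈-lookup _) (at-∈ 0F) (p≢q ∘ at-inj))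
      adjacent 1F (suc (suc (suc (suc q)))) p≢q _ = Nb-sym (universal (∈-lookup _) (at-∈ 1F) (p≢q ∘ at-inj))
      adjacent 2F (suc (suc (suc (suc q)))) p≢q _ = Nb-sym (universal (∈-lookup _) (at-∈ 2F) (p≢q ∘ at-inj))
      adjacent 3F (suc (suc (suc (suc q)))) p≢q _ = Nb-sym (universal (∈-lookup _) (at-∈ 3F) (p≢q ∘ at-inj))
      adjacent 0F 0F p≢q _ = contradiction refl p≢q
      adjacent 1F 1F p≢q _ = contradiction refl p≢q
      adjacent 2F 2F p≢q _ = contradiction refl p≢q
      adjacent 3F 3F p≢q _ = contradiction refl p≢q
      adjacent 0F 1F _ _ = s∈N
      adjacent 1F 0F _ _ = Nb-sym s∈N
      adjacent 2F 3F _ _ = o′∈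
      adjacent 3F 2F _ _ = Nb-sym o′∈

      adjacent⁻ : ∀ p q → at q ∈ Nb (at p) → Bool.T (K₉-K₂₂-adj p q)
      adjacent⁻ (suc (suc (suc (suc p)))) q _ = tt
      adjacent⁻ 0F (suc (suc (suc (suc q)))) _ = tt
      adjacent⁻ 1F (suc (suc (suc (suc q)))) _ = tt
      adjacent⁻ 2F (suc (suc (suc (suc q)))) _ = tt
      adjacent⁻ 3F (suc (suc (suc (suc q)))) _ = tt
      adjacent⁻ 0F 0F _ = tt
      adjacent⁻ 0F 1F _ = tt
      adjacent⁻ 1F 0F _ = tt
      adjacent⁻ 1F 1F _ = tt
      adjacent⁻ 2F 2F _ = tt
      adjacent⁻ 2F 3F _ = tt
      adjacent⁻ 3F 2F _ = tt
      adjacent⁻ 3F 3F _ = tt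
      adjacent⁻ 0F 2F = x∉Nb-o ∘ Nb-sym
      adjacent⁻ 0F 3F = x∉Nb-o′ ∘ Nb-sym
      adjacent⁻ 1F 2F = s∉Nb-o ∘ Nb-sym
      adjacent⁻ 1F 3F = s∉Nb-o′ ∘ Nb-sym
      adjacent⁻ 2F 0F = x∉Nb-o
      adjacent⁻ 2F 1F = s∉Nb-o
      adjacent⁻ 3F 0F = x∉Nb-o′
      adjacent⁻ 3F 1F = s∉Nb-o′

      joined : ∀ {p q} → p ≢ q → Bool.T (K₉-K₂₂-adj p q) → ∀ i → Joint i (at p) (at q)
      joined {p} {q} p≢q pq = proj₂ (Nb⁻ (adjacent p q p≢q pq))
      closed : ∀ i {p z} → at p ≢ z → Joint i (at p) z → ∃[ q ] z ≡ at q × Bool.T (K₉-K₂₂-adj p q)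
      closed i {p} p≢z pz =
        let z∈ = Nb⁺ {i} p≢z pz
            (q , z≡q) = ∈⇒at (F⊆G (Nb-F z∈))
        in q , z≡q , adjacent⁻ p q (subst (_∈ Nb (at p)) z≡q z∈)
      open Configuration trade linear {e = at} at-inj K₉-K₂₂-adj joined closed

  impossible : ⊥
  impossible with All.all? (λ s → deg s ≤? 3) S
  ... | yes light = K₇-impossible light
  ... | no ¬light =
    let (s , s∈S , ¬≤3) = find (All.¬All⇒Any¬ (λ s → deg s ≤? 3) S ¬light)
        (o , o′ , (o∈ , o∉S) , (o′∈ , o′∉S) , o≢o′) = two-outside s∈S (≰⇒> ¬≤3)
        open NinePoints (Nb-active o∈) (Nb-active o′∈) o∉S o′∉S o≢o′
    in K₉-K₃-impossible K₉-K₂₂-impossible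

theorem3p6 : (v : ℕ) (T : Fin 5 → List (Subset v)) → IsMuWayTrade 5 v 3 2 T → ∀ (i : Fin 5) → 12 ≤ length (T i)
theorem3p6 v T trade i = ≮⇒≥ λ { (s≤s small) →
  let (x , x-active , x-light) = Small.light-point T trade i small
  in Light.impossible T trade i small x-active x-light }
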